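{- Let $n\ge 3$, $1\le t<n$, and let $c_1,c_2,\ldots,c_t\in[n]$ be distinct integers such that the sequence $(c_1,\ldots,c_t)$ avoids both patterns $213$ and $231$. If $(c_1,\ldots,c_t)$ is a shuffle of $(1,2,\ldots,t-s)$ and $(n,n-1,\ldots,n-s+1)$ for some $s\in\{0,1,\ldots,t\}$, then $$|S_{n,(c_1,\ldots,c_t)}(213,231)|=2^{n-t-1};$$ otherwise, $|S_{n,(c_1,\ldots,c_t)}(213,231)|=0$.
   Context: $[n]=\{1,\ldots,n\}$ and $S_n$ is the set of permutations of $[n]$ written as sequences $(\tau(1),\ldots,\tau(n))$. A sequence of distinct integers $\tau=(\tau(1),\ldots,\tau(m))$ contains $\sigma\in S_k$ as a pattern if there are indices $1\le i_1<\cdots<i_k\le m$ such that for all $1\le a<b\le k$, $\tau(i_a)<\tau(i_b)$ if and only if $\sigma(a)<\sigma(b)$; otherwise $\tau$ avoids $\sigma$. $S_{n,(c_1,\ldots,c_t)}(\sigma_1,\ldots,\sigma_m)$ is the set of $\tau\in S_n$ with $(\tau(1),\ldots,\tau(t))=(c_1,\ldots,c_t)$ that avoid all of $\sigma_1,\ldots,\sigma_m$. If $\sigma$ and $\tau$ are arrangements (permutations) of disjoint finite sets $A$ and $B$, a shuffle of $\sigma$ and $\tau$ is an arrangement of $A\cup B$ in which the elements of $A$ appear in the order given by $\sigma$ and the elements of $B$ appear in the order given by $\tau$. When $s=0$ the condition means $(c_1,\ldots,c_t)=(1,2,\ldots,t)$; when $s=t$ it means $(c_1,\ldots,c_t)=(n,n-1,\ldots,n-t+1)$.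 -}

module Defs where

open import Data.Fin.Base as Fin using (Fin)
open import Data.List.Base using (List; []; _∷_; length; lookup; take; applyUpTo)
open import Data.List.Membership.Propositional using (_∈_)
open import Data.List.Relation.Binary.Permutation.Propositional using (_↭_)
open import Data.List.Relation.Ternary.Interleaving.Propositional using (Interleaving)
open import Data.List.Relation.Unary.All using (All)
open import Data.List.Relation.Unary.Unique.Propositional using (Unique)
open import Data.Nat.Base using (ℕ; suc; _∸_; _<_)
open import Data.Product.Base using (∃-syntax; Σ-syntax; _×_)
open import Function.Bundles using (_⇔_)
open import Relation.Binary.PropositionalEquality.Core using (_≡_)
open import Relation.Nullary.Negation.Core using (¬_)

-- Sequences, including permutations in one-line notation, are lists of
-- (one-based) natural numbers.

[1⋯_] : ℕ → List ℕ
[1⋯ n ] = applyUpTo suc n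

-- (n , n-1 , … , n-s+1); only used with s ≤ n, so ∸ never truncates.
top : ℕ → ℕ → List ℕ
top n s = applyUpTo (n ∸_) s

Contains : List ℕ → List ℕ → Set
Contains τ σ =
  Σ[ i ∈ (Fin (length σ) → Fin (length τ)) ]
    (∀ a b → a Fin.< b → i a Fin.< i b)
    × (∀ a b → a Fin.< b →
         (lookup τ (i a) < lookup τ (i b)) ⇔ (lookup σ a < lookup σ b))

Avoids : List ℕ → List ℕ → Set
Avoids τ σ = ¬ Contains τ σ

-- τ ∈ S n c σs: τ is a permutation of [n] that starts with c and avoids
-- every pattern in σs.
S : ℕ → List ℕ → List (List ℕ) → List ℕ → Set
S n c σs τ = τ ↭ [1⋯ n ] × take (length c) τ ≡ c × All (Avoids τ) σs

-- The set { x | P x } is finite with exactly k elements: it is listed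
-- without repetition by some list of length k.
HasCardinality : {A : Set} → (A → Set) → ℕ → Set
HasCardinality P k =
  ∃[ xs ] Unique xs × (∀ x → x ∈ xs ⇔ P x) × length xs ≡ k

-- Argument order: π is a shuffle of σ and τ.  For σ and τ without common
-- entries, an interleaving is exactly an arrangement of their entries that
-- keeps the order of each.
_IsShuffleOf_And_ : List ℕ → List ℕ → List ℕ → Set
π IsShuffleOf σ And τ = Interleaving σ τ π

p213 p231 : List ℕ
p213 = 2 ∷ 1 ∷ 3 ∷ []
p231 = 2 ∷ 3 ∷ 1 ∷ []

{-# OPTIONS --safe #-}

-- A permutation of an interval avoids 213 and 231 exactly when no entry has
-- both a smaller and a larger entry to its right, that is, when each entry is
-- the minimum or the maximum of the entries not yet used.  Hence the entries
-- are read off from the two ends of the interval: a prefix is a shuffle of an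
-- initial segment and a reversed final segment, it leaves an interval, and each
-- later entry except the last one is a free choice between two ends.

module Submission where

open import Defs
open import Data.Fin.Base as Fin using (Fin; zero; suc)
open import Data.Fin.Properties as Fin using ()
open import Data.List.Base using (List; []; _∷_; [_]; _++_; length; lookup; take; drop; map; applyUpTo)
open import Data.List.Membership.Propositional using (_∈_)
open import Data.List.Membership.Propositional.Properties
  using (∈-lookup; ∈-++⁺ˡ; ∈-++⁺ʳ; ∈-++⁻; ∈-map⁺; ∈-map⁻)
open import Data.List.Properties
  using (∷-injectiveˡ; ∷-injectiveʳ; length-map; length-++; ++-cancelˡ; take++drop≡id)
open import Data.List.Relation.Binary.Permutation.Propositional
  using (_↭_; refl; prep; ↭-sym; ↭-trans; ↭-reflexive; ↭⇒↭ₛ)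
open import Data.List.Relation.Binary.Permutation.Propositional.Properties
  using (All-resp-↭; ∈-resp-↭; drop-∷; ∷↭∷ʳ; ↭-empty-inv; ¬x∷xs↭[])
import Data.List.Relation.Binary.Permutation.Setoid.Properties as SetoidPermutation
open import Data.List.Relation.Ternary.Interleaving.Propositional
  using (Interleaving; []; consˡ; consʳ)
open import Data.List.Relation.Unary.All as All using (All; []; _∷_)
open import Data.List.Relation.Unary.All.Properties using (¬Any⇒All¬)
open import Data.List.Relation.Unary.AllPairs using ([]; _∷_)
open import Data.List.Relation.Unary.Any as Any using (Any; here; there)
open import Data.List.Relation.Unary.Any.Properties using (lookup-index)
open import Data.List.Relation.Unary.Unique.Propositional using (Unique)
open import Data.List.Relation.Unary.Unique.Propositional.Properties as Unique using ()
open import Data.Nat.Base using (ℕ; zero; suc; _+_; _∸_; _^_; _≤_; _<_; s≤s; s≤s⁻¹; s<s⁻¹; z<s)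
open import Data.Nat.Properties
open import Data.Product.Base using (∃-syntax; _×_; _,_)
open import Data.Sum.Base using (_⊎_; inj₁; inj₂)
open import Data.Unit.Base using (⊤; tt)
open import Function.Base using (_∘_)
open import Function.Bundles using (_⇔_; mk⇔; Equivalence)
open import Relation.Binary.Definitions using (tri<; tri≈; tri>)
open import Relation.Binary.PropositionalEquality
  using (_≡_; _≢_; refl; sym; trans; cong; cong₂; subst; setoid)
open import Relation.Nullary.Decidable.Core using (yes; no; from-yes; from-no)
open import Relation.Nullary.Negation.Core using (¬_; contradiction)

-- Pattern avoidance in terms of extremal entries

Extremal : List ℕ → Set
Extremal []       = ⊤
Extremal (x ∷ xs) = (All (x <_) xs ⊎ All (_< x) xs) × Extremal xs

Contains-∷ : ∀ {x xs σ} → Contains xs σ → Contains (x ∷ xs) σ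
Contains-∷ (i , mono , order) = suc ∘ i , (λ a b a<b → s≤s (mono a b a<b)) , order

-- Builds an occurrence that starts at the head of the list, so that only the three comparisons
-- between pattern entries remain to be supplied.
contains₃ : ∀ x xs p q r (j k : Fin (length xs)) → j Fin.< k →
  (x < lookup xs j ⇔ p < q) → (x < lookup xs k ⇔ p < r) →
  (lookup xs j < lookup xs k ⇔ q < r) →
  Contains (x ∷ xs) (p ∷ q ∷ r ∷ [])
contains₃ x xs p q r j k j<k pq pr qr = i , mono , order
  where
  i : Fin 3 → Fin (length (x ∷ xs))
  i zero             = zero
  i (suc zero)       = suc j
  i (suc (suc zero)) = suc k

  mono : ∀ a b → a Fin.< b → i a Fin.< i b
  mono zero             (suc zero)       _ = z<s
  mono zero             (suc (suc zero)) _ = z<s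
  mono (suc zero)       (suc (suc zero)) _ = s≤s j<k
  mono (suc zero)       (suc zero)       (s≤s ())
  mono (suc (suc zero)) (suc zero)       (s≤s ())
  mono (suc (suc zero)) (suc (suc zero)) (s≤s (s≤s ()))

  order : ∀ a b → a Fin.< b → (lookup (x ∷ xs) (i a) < lookup (x ∷ xs) (i b)) ⇔
    (lookup (p ∷ q ∷ r ∷ []) a < lookup (p ∷ q ∷ r ∷ []) b)
  order zero             (suc zero)       _ = pq
  order zero             (suc (suc zero)) _ = pr
  order (suc zero)       (suc (suc zero)) _ = qr
  order (suc zero)       (suc zero)       (s≤s ())
  order (suc (suc zero)) (suc zero)       (s≤s ())
  order (suc (suc zero)) (suc (suc zero)) (s≤s (s≤s ()))

both-true : {A B : Set} → A → B → A ⇔ B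
both-true a b = mk⇔ (λ _ → b) (λ _ → a)

both-false : {A B : Set} → ¬ A → ¬ B → A ⇔ B
both-false ¬a ¬b = mk⇔ (λ a → contradiction a ¬a) (λ b → contradiction b ¬b)

-- With `x` in the role of 2, a smaller and a larger later entry form 213 if the smaller one comes
-- first and 231 if the larger one does.
avoids⇒¬straddle : ∀ {x xs} → Avoids (x ∷ xs) p213 → Avoids (x ∷ xs) p231 →
  Any (_< x) xs → ¬ Any (x <_) xs
avoids⇒¬straddle {x} {xs} av213 av231 below above =
  go (Any.index below) (Any.index above) (lookup-index below) (lookup-index above)
  where
  1<2 : 1 < 2
  1<2 = from-yes (1 <? 2)
  1<3 : 1 < 3
  1<3 = from-yes (1 <? 3)
  2<3 : 2 < 3
  2<3 = from-yes (2 <? 3)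

  go : ∀ j k → lookup xs j < x → ¬ x < lookup xs k
  go j k j<x x<k with Fin.<-cmp j k
  ... | tri< j<k _ _ = av213 (contains₃ x xs 2 1 3 j k j<k
    (both-false (<-asym j<x) (<-asym 1<2)) (both-true x<k 2<3)
    (both-true (<-trans j<x x<k) 1<3))
  ... | tri≈ _ refl _ = <-asym j<x x<k
  ... | tri> _ _ k<j = av231 (contains₃ x xs 2 3 1 k j k<j
    (both-true x<k 2<3) (both-false (<-asym j<x) (<-asym 1<2))
    (both-false (<-asym (<-trans j<x x<k)) (<-asym 1<3)))

avoids⇒extremal : ∀ {τ} → Unique τ → Avoids τ p213 → Avoids τ p231 → Extremal τ
avoids⇒extremal []               av213 av231 = tt
avoids⇒extremal {x ∷ xs} (x∉xs ∷ uniq) av213 av231 =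
  head , avoids⇒extremal uniq (av213 ∘ Contains-∷) (av231 ∘ Contains-∷)
  where
  head : All (x <_) xs ⊎ All (_< x) xs
  head with Any.any? (_<? x) xs
  ... | yes below = inj₂ (All.zipWith
    (λ (x≢y , x≮y) → ≤∧≢⇒< (≮⇒≥ x≮y) (x≢y ∘ sym))
    (x∉xs , ¬Any⇒All¬ xs (avoids⇒¬straddle av213 av231 below)))
  ... | no ¬below = inj₁ (All.zipWith
    (λ (x≢y , y≮x) → ≤∧≢⇒< (≮⇒≥ y≮x) x≢y)
    (x∉xs , ¬Any⇒All¬ xs ¬below))

-- An entry below some later entry is not the maximum of its suffix, so it is the minimum. Positions
-- are used to match the shape of `Contains`.
extremal⇒¬straddle : ∀ τ → Extremal τ → ∀ i j k → i Fin.< j → i Fin.< k →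
  lookup τ i < lookup τ j → lookup τ i < lookup τ k
extremal⇒¬straddle (x ∷ xs) (inj₁ x<xs , _) zero (suc j) (suc k) _ _ _ =
  All.lookup x<xs (∈-lookup k)
extremal⇒¬straddle (x ∷ xs) (inj₂ xs<x , _) zero (suc j) (suc k) _ _ x<j =
  contradiction x<j (<-asym (All.lookup xs<x (∈-lookup j)))
extremal⇒¬straddle (x ∷ xs) (_ , ext) (suc i) (suc j) (suc k) i<j i<k =
  extremal⇒¬straddle xs ext i j k (s<s⁻¹ i<j) (s<s⁻¹ i<k)

-- Covers both patterns at once: `suc j` is a position of `σ` whose entry exceeds the first one,
-- `suc k` one whose entry does not. An occurrence would force the first entry to lie below both.
extremal⇒avoids : ∀ {τ p q r} → Extremal τ → (j k : Fin 2) →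
  let σ = p ∷ q ∷ r ∷ [] in
  p < lookup σ (suc j) → ¬ p < lookup σ (suc k) → Avoids τ σ
extremal⇒avoids {τ} ext j k p<j p≮k (i , mono , order) =
  p≮k (to (order zero (suc k) z<s)
    (extremal⇒¬straddle τ ext (i zero) (i (suc j)) (i (suc k))
      (mono zero (suc j) z<s) (mono zero (suc k) z<s) (from (order zero (suc j) z<s) p<j)))
  where open Equivalence

-- Intervals as increasing lists

-- The explicit lower end `l` lets an interval without its minimum be again of the form `up`, by
-- computation; `up-↭` does the same for the maximum, up to permutation.
up : ℕ → ℕ → List ℕ
up l zero    = []
up l (suc m) = suc l ∷ up (suc l) m

applyUpTo≡up : ∀ (f : ℕ → ℕ) l m → (∀ i → f i ≡ suc (l + i)) → applyUpTo f m ≡ up l m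
applyUpTo≡up f l zero    f≗ = refl
applyUpTo≡up f l (suc m) f≗ = cong₂ _∷_ (trans (f≗ 0) (cong suc (+-identityʳ l)))
  (applyUpTo≡up (f ∘ suc) (suc l) m (λ i → trans (f≗ (suc i)) (cong suc (+-suc l i))))

[1⋯]≡up : ∀ n → [1⋯ n ] ≡ up 0 n
[1⋯]≡up n = applyUpTo≡up suc 0 n (λ _ → refl)

up-lower : ∀ l m → All (l <_) (up l m)
up-lower l zero    = []
up-lower l (suc m) = ≤-refl ∷ All.map (<-trans (n<1+n l)) (up-lower (suc l) m)

up-upper : ∀ l m → All (_< suc (l + m)) (up l m)
up-upper l zero    = []
up-upper l (suc m) rewrite +-suc l m = s≤s (s≤s (m≤m+n l m)) ∷ up-upper (suc l) m

up-unique : ∀ l m → Unique (up l m)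
up-unique l zero    = []
up-unique l (suc m) = All.map <⇒≢ (up-lower (suc l) m) ∷ up-unique (suc l) m

up-∷ʳ : ∀ l m → up l m ++ [ suc (l + m) ] ≡ up l (suc m)
up-∷ʳ l zero    = cong (λ x → [ suc x ]) (+-identityʳ l)
up-∷ʳ l (suc m) rewrite +-suc l m = cong (suc l ∷_) (up-∷ʳ (suc l) m)

up-↭ : ∀ l m → suc (l + m) ∷ up l m ↭ up l (suc m)
up-↭ l m = ↭-trans (∷↭∷ʳ (suc (l + m)) (up l m)) (↭-reflexive (up-∷ʳ l m))

-- Peeling an interval from its two ends

-- The interval is {l+1 , … , l+m}.  When m = 1 both constructors give the same τ.
data Peeling : ℕ → ℕ → List ℕ → Set where
  []   : ∀ {l} → Peeling l 0 []
  low  : ∀ {l m x xs} → x ≡ suc l → Peeling (suc l) m xs → Peeling l (suc m) (x ∷ xs)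
  high : ∀ {l m x xs} → x ≡ suc (l + m) → Peeling l m xs → Peeling l (suc m) (x ∷ xs)

peeling⇒↭ : ∀ {l m τ} → Peeling l m τ → τ ↭ up l m
peeling⇒↭ []                     = refl
peeling⇒↭ (low refl p)           = prep _ (peeling⇒↭ p)
peeling⇒↭ {l} (high {m = m} refl p) = ↭-trans (prep _ (peeling⇒↭ p)) (up-↭ l m)

peeling⇒extremal : ∀ {l m τ} → Peeling l m τ → Extremal τ
peeling⇒extremal []              = tt
peeling⇒extremal (low refl p)    =
  inj₁ (All-resp-↭ (↭-sym (peeling⇒↭ p)) (up-lower _ _)) , peeling⇒extremal p
peeling⇒extremal (high refl p)   =
  inj₂ (All-resp-↭ (↭-sym (peeling⇒↭ p)) (up-upper _ _)) , peeling⇒extremal p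

-- The minimum of the interval occurs in `τ`. If it came after a head that is below all later
-- entries, the head would lie below the interval. The case of the maximum is dual.
extremal⇒peeling : ∀ l m τ → τ ↭ up l m → Extremal τ → Peeling l m τ
extremal⇒peeling l zero τ τ↭ _ with refl ← ↭-empty-inv τ↭ = []
extremal⇒peeling l (suc m) [] τ↭ _ = contradiction (↭-sym τ↭) ¬x∷xs↭[]
extremal⇒peeling l (suc m) (x ∷ xs) τ↭ (inj₁ x<xs , ext) =
  low x≡ (extremal⇒peeling (suc l) m xs (drop-∷ (subst (λ y → y ∷ xs ↭ up l (suc m)) x≡ τ↭)) ext)
  where
  x≡ : x ≡ suc l
  x≡ with ∈-resp-↭ (↭-sym τ↭) (here refl)
  ... | here eq = sym eq
  ... | there l∈xs = contradiction (All.lookup x<xs l∈xs)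
    (≤⇒≯ (All.head (All-resp-↭ (↭-sym τ↭) (up-lower l (suc m)))))
extremal⇒peeling l (suc m) (x ∷ xs) τ↭ (inj₂ xs<x , ext) =
  high x≡ (extremal⇒peeling l m xs (drop-∷ (subst (λ y → y ∷ xs ↭ _) x≡ τ↭′)) ext)
  where
  -- Moving the maximum to the front allows it to be cancelled against `x`.
  τ↭′ : x ∷ xs ↭ suc (l + m) ∷ up l m
  τ↭′ = ↭-trans τ↭ (↭-sym (up-↭ l m))
  x≡ : x ≡ suc (l + m)
  x≡ with ∈-resp-↭ (↭-sym τ↭′) (here refl)
  ... | here eq = sym eq
  ... | there h∈xs = contradiction (All.lookup xs<x h∈xs) (≤⇒≯
    (subst (x ≤_) (+-suc l m)
      (s≤s⁻¹ (All.head (All-resp-↭ (↭-sym τ↭) (up-upper l (suc m)))))))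

-- Enumerating and counting peelings

-- peelings l m lists the τ with Peeling l (suc m) τ.
peelings : ℕ → ℕ → List (List ℕ)
peelings l zero    = [ [ suc l ] ]
peelings l (suc m) =
  map (suc l ∷_) (peelings (suc l) m) ++ map (suc (l + suc m) ∷_) (peelings l m)

∈-peelings⁺ : ∀ l m {τ} → Peeling l (suc m) τ → τ ∈ peelings l m
∈-peelings⁺ l zero    (low refl [])  = here refl
∈-peelings⁺ l zero    (high refl []) = here (cong (λ x → [ suc x ]) (+-identityʳ l))
∈-peelings⁺ l (suc m) (low refl p)   =
  ∈-++⁺ˡ (∈-map⁺ (suc l ∷_) (∈-peelings⁺ (suc l) m p))
∈-peelings⁺ l (suc m) (high refl p)  =
  ∈-++⁺ʳ (map (suc l ∷_) (peelings (suc l) m))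
    (∈-map⁺ (suc (l + suc m) ∷_) (∈-peelings⁺ l m p))

∈-peelings⁻ : ∀ l m {τ} → τ ∈ peelings l m → Peeling l (suc m) τ
∈-peelings⁻ l zero    (here refl) = low refl []
∈-peelings⁻ l (suc m) τ∈ with ∈-++⁻ (map (suc l ∷_) (peelings (suc l) m)) τ∈
... | inj₁ τ∈ˡ with _ , xs∈ , refl ← ∈-map⁻ (suc l ∷_) τ∈ˡ =
  low refl (∈-peelings⁻ (suc l) m xs∈)
... | inj₂ τ∈ʳ with _ , xs∈ , refl ← ∈-map⁻ (suc (l + suc m) ∷_) τ∈ʳ =
  high refl (∈-peelings⁻ l m xs∈)

-- The two halves are disjoint because their lists start with opposite ends of an interval of at
-- least two elements.
peelings-unique : ∀ l m → Unique (peelings l m)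
peelings-unique l zero    = [] ∷ []
peelings-unique l (suc m) = Unique.++⁺
  (Unique.map⁺ ∷-injectiveʳ (peelings-unique (suc l) m))
  (Unique.map⁺ ∷-injectiveʳ (peelings-unique l m))
  λ (∈ˡ , ∈ʳ) → disjoint (∈-map⁻ (suc l ∷_) ∈ˡ) (∈-map⁻ (suc (l + suc m) ∷_) ∈ʳ)
  where
  disjoint : ∀ {τ} → ∃[ xs ] xs ∈ peelings (suc l) m × τ ≡ suc l ∷ xs →
    ¬ (∃[ xs ] xs ∈ peelings l m × τ ≡ suc (l + suc m) ∷ xs)
  disjoint (_ , _ , eq) (_ , _ , eq′) =
    m≢1+m+n l (trans (suc-injective (∷-injectiveˡ (trans (sym eq) eq′))) (+-suc l m))

length-peelings : ∀ l m → length (peelings l m) ≡ 2 ^ m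
length-peelings l zero    = refl
length-peelings l (suc m) = trans (length-++ (map (suc l ∷_) (peelings (suc l) m)))
  (cong₂ _+_ (trans (length-map _ (peelings (suc l) m)) (length-peelings (suc l) m))
    (trans (trans (length-map _ (peelings l m)) (length-peelings l m))
      (sym (+-identityʳ (2 ^ m)))))

-- Shuffles as prefixes of peelings

-- The tail of the descending run is left as an `applyUpTo`; it computes to `top` of the predecessor
-- as soon as `n` is a successor.
shuffle-∷⁻ : ∀ {l n x c} u s → Interleaving (up l u) (top n s) (x ∷ c) →
  (∃[ u′ ] u ≡ suc u′ × x ≡ suc l × Interleaving (up (suc l) u′) (top n s) c) ⊎
  (∃[ s′ ] s ≡ suc s′ × x ≡ n × Interleaving (up l u) (applyUpTo (λ i → n ∸ suc i) s′) c)
shuffle-∷⁻ (suc u) zero    (consˡ sh) = inj₁ (u , refl , refl , sh)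
shuffle-∷⁻ (suc u) (suc s) (consˡ sh) = inj₁ (u , refl , refl , sh)
shuffle-∷⁻ zero    (suc s) (consʳ sh) = inj₂ (s , refl , refl , sh)
shuffle-∷⁻ (suc u) (suc s) (consʳ sh) = inj₂ (s , refl , refl , sh)

-- Each entry of the shuffle is one peeling step: from the increasing run a `low` step, which raises
-- `l`, from the decreasing run a `high` step, which lowers `n`. After `u` steps of the first kind
-- the lower end is `l + u`.
peeling-++⁺ : ∀ {l m n k} c {d} u s → n ≡ l + m → m ≡ u + s + k →
  Interleaving (up l u) (top n s) c → Peeling (l + u) k d → Peeling l m (c ++ d)
peeling-++⁺ {l} {m} [] zero zero n≡ refl [] p = subst (λ l′ → Peeling l′ m _) (+-identityʳ l) p
peeling-++⁺ {l} {k = k} (x ∷ c) {d} u s n≡ m≡ sh p with shuffle-∷⁻ u s sh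
... | inj₁ (u′ , refl , refl , sh′) with refl ← m≡ =
  low refl (peeling-++⁺ c u′ s (trans n≡ (+-suc l _)) refl sh′
    (subst (λ l′ → Peeling l′ k d) (+-suc l u′) p))
... | inj₂ (s′ , refl , refl , sh′)
  with refl ← trans m≡ (cong (_+ k) (+-suc u s′))
  -- Exposes `n` as a successor, so that the rest of the decreasing run becomes a `top` again.
  with refl ← trans n≡ (+-suc l _) =
  high refl (peeling-++⁺ c u s′ refl refl sh′ p)

ends-differ : ∀ l r k → l ≢ l + (r + suc k)
ends-differ l r k eq = m≢1+m+n l (trans eq (trans (cong (l +_) (+-suc r k)) (+-suc l (r + k))))

-- Since something is left after c, the two ends of what remains differ at each
-- entry of c, so the shuffle and the peeling take the same end.
peeling-++⁻ : ∀ {l m n k} c {d} u s → n ≡ l + m → m ≡ u + s + suc k →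
  Interleaving (up l u) (top n s) c → Peeling l m (c ++ d) → Peeling (l + u) (suc k) d
peeling-++⁻ {l} {m} [] zero zero n≡ refl [] p =
  subst (λ l′ → Peeling l′ m _) (sym (+-identityʳ l)) p
peeling-++⁻ {l} {k = k} (x ∷ c) {d} u s n≡ m≡ sh p with shuffle-∷⁻ u s sh
... | inj₁ (u′ , refl , refl , sh′) with refl ← m≡ | p
...   | low _ p′ = subst (λ l′ → Peeling l′ (suc k) d) (sym (+-suc l u′))
  (peeling-++⁻ c u′ s (trans n≡ (+-suc l _)) refl sh′ p′)
...   | high eq _ = contradiction (suc-injective eq) (ends-differ l (u′ + s) k)
peeling-++⁻ {l} {k = k} (x ∷ c) u s n≡ m≡ sh p | inj₂ (s′ , refl , refl , sh′)
  with refl ← trans m≡ (cong (_+ suc k) (+-suc u s′))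
  with refl ← trans n≡ (+-suc l _)
  with p
... | high _ p′ = peeling-++⁻ c u s′ refl refl sh′ p′
... | low eq _  = contradiction (sym (suc-injective eq)) (ends-differ l (u + s′) k)

-- The witnesses `u` and `s` count the `low` and `high` steps taken along `c`.
peeling⇒shuffle : ∀ {l m n} c {d} → n ≡ l + m → Peeling l m (c ++ d) →
  ∃[ u ] ∃[ s ] u + s ≡ length c × Interleaving (up l u) (top n s) c
peeling⇒shuffle []      n≡ p = 0 , 0 , refl , []
peeling⇒shuffle {l} (x ∷ c) n≡ (low refl p)
  with u , s , len , sh ← peeling⇒shuffle c (trans n≡ (+-suc l _)) p =
  suc u , s , cong suc len , consˡ sh
peeling⇒shuffle {l} (x ∷ c) n≡ (high refl p) with refl ← trans n≡ (+-suc l _)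
  with u , s , len , sh ← peeling⇒shuffle c refl p =
  u , suc s , trans (+-suc u s) (cong suc len) , consʳ sh

-- Cardinality of the set of avoiding permutations

take-length-++ : {A : Set} (xs ys : List A) → take (length xs) (xs ++ ys) ≡ xs
take-length-++ []       ys = refl
take-length-++ (x ∷ xs) ys = cong (x ∷_) (take-length-++ xs ys)

S⁺ : ∀ {n c d} → Peeling 0 n (c ++ d) → S n c (p213 ∷ p231 ∷ []) (c ++ d)
S⁺ {n} {c} {d} p =
  subst (c ++ d ↭_) (sym ([1⋯]≡up n)) (peeling⇒↭ p) ,
  take-length-++ c d ,
  -- The 3 is last in 213 and in the middle in 231, hence the swapped positions.
  extremal⇒avoids ext (suc zero) zero (from-yes (2 <? 3)) (from-no (2 <? 1)) ∷
  extremal⇒avoids ext zero (suc zero) (from-yes (2 <? 3)) (from-no (2 <? 1)) ∷ []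
  where
  ext : Extremal (c ++ d)
  ext = peeling⇒extremal p

S⁻ : ∀ {n c τ} → S n c (p213 ∷ p231 ∷ []) τ → ∃[ d ] τ ≡ c ++ d × Peeling 0 n (c ++ d)
S⁻ {n} {c} {τ} (τ↭ , prefix , av213 ∷ av231 ∷ []) =
  drop (length c) τ , τ≡ , subst (Peeling 0 n) τ≡
    (extremal⇒peeling 0 n τ τ↭up (avoids⇒extremal unique av213 av231))
  where
  τ≡ : τ ≡ c ++ drop (length c) τ
  τ≡ = trans (sym (take++drop≡id (length c) τ)) (cong (_++ drop (length c) τ) prefix)

  τ↭up : τ ↭ up 0 n
  τ↭up = subst (τ ↭_) ([1⋯]≡up n) τ↭

  unique : Unique τ
  unique = SetoidPermutation.Unique-resp-↭ (setoid ℕ) (↭⇒↭ₛ (↭-sym τ↭up)) (up-unique 0 n)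

-- The completions of `c` are the peelings of the remaining interval from `u + 1` to `u + k + 1`,
-- whose last entry is forced.
card-S-shuffle : ∀ {n c} u s k → n ≡ u + s + suc k → Interleaving (up 0 u) (top n s) c →
  HasCardinality (S n c (p213 ∷ p231 ∷ [])) (2 ^ k)
card-S-shuffle {n} {c} u s k n≡ sh =
  map (c ++_) (peelings u k) ,
  Unique.map⁺ (++-cancelˡ c _ _) (peelings-unique u k) ,
  (λ τ → mk⇔ sound complete) ,
  trans (length-map (c ++_) (peelings u k)) (length-peelings u k)
  where
  sound : ∀ {τ} → τ ∈ map (c ++_) (peelings u k) → S n c (p213 ∷ p231 ∷ []) τ
  sound τ∈ with d , d∈ , refl ← ∈-map⁻ (c ++_) τ∈ =
    S⁺ (peeling-++⁺ c u s refl n≡ sh (∈-peelings⁻ u k d∈))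

  complete : ∀ {τ} → S n c (p213 ∷ p231 ∷ []) τ → τ ∈ map (c ++_) (peelings u k)
  complete τ∈S with d , refl , p ← S⁻ τ∈S =
    ∈-map⁺ (c ++_) (∈-peelings⁺ u k (peeling-++⁻ c u s refl n≡ sh p))

theorem5p3 : ∀ (n t : ℕ) (c : List ℕ) →
    3 ≤ n → 1 ≤ t → t < n →
    length c ≡ t → All (_∈ [1⋯ n ]) c → Unique c →
    Avoids c p213 → Avoids c p231 →
    let IsShuffle = ∃[ s ] s ≤ t × c IsShuffleOf [1⋯ t ∸ s ] And top n s in
    (IsShuffle → HasCardinality (S n c (p213 ∷ p231 ∷ [])) (2 ^ (n ∸ t ∸ 1)))
    × (¬ IsShuffle → HasCardinality (S n c (p213 ∷ p231 ∷ [])) 0)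
theorem5p3 n t c _ _ t<n refl _ _ _ _ = shuffle , ¬shuffle
  where
  shuffle : ∃[ s ] s ≤ t × c IsShuffleOf [1⋯ t ∸ s ] And top n s →
    HasCardinality (S n c (p213 ∷ p231 ∷ [])) (2 ^ (n ∸ t ∸ 1))
  shuffle (s , s≤t , sh) = card-S-shuffle (t ∸ s) s (n ∸ t ∸ 1) n≡
    (subst (λ xs → Interleaving xs (top n s) c) ([1⋯]≡up (t ∸ s)) sh)
    where
    -- No subtraction truncates: `s ≤ t` recovers `t` from its two runs, and `t < n` makes `n ∸ t`
    -- positive.
    n≡ : n ≡ t ∸ s + s + suc (n ∸ t ∸ 1)
    n≡ = trans (sym (m+[n∸m]≡n (<⇒≤ t<n)))
      (cong₂ _+_ (sym (m∸n+n≡m s≤t)) (sym (m+[n∸m]≡n (m<n⇒0<n∸m t<n))))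

  ¬shuffle : ¬ (∃[ s ] s ≤ t × c IsShuffleOf [1⋯ t ∸ s ] And top n s) →
    HasCardinality (S n c (p213 ∷ p231 ∷ [])) 0
  ¬shuffle ¬sh = [] , [] , (λ τ → mk⇔ (λ ()) (λ τ∈S → contradiction (is-shuffle τ∈S) ¬sh)) , refl
    where
    -- A single member already exhibits `c` as a shuffle; `u + s ≡ t` turns the length `u` of the
    -- increasing run into `t ∸ s`.
    is-shuffle : ∀ {τ} → S n c (p213 ∷ p231 ∷ []) τ →
      ∃[ s ] s ≤ t × c IsShuffleOf [1⋯ t ∸ s ] And top n s
    is-shuffle τ∈S with d , _ , p ← S⁻ τ∈S
      with u , s , len , sh ← peeling⇒shuffle c refl p =
      s , subst (s ≤_) len (m≤n+m s u) ,
      subst (λ xs → Interleaving xs (top n s) c)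
        (trans (sym ([1⋯]≡up u)) (cong [1⋯_] (trans (sym (m+n∸n≡m u s)) (cong (_∸ s) len)))) sh
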